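{- Let $G$ be a connected graph on $n$ vertices. If $G$ contains no heavy cycles, then $G$ has at most two heavy vertices. Moreover, still assuming that $G$ contains no heavy cycles: (1) if $G$ contains no heavy vertices, then $G$ is a tree; (2) if $G$ contains only one heavy vertex, say $x$, then $G-x$ contains at least $n/2$ components, and each component of $G-x$ contains exactly one neighbor of $x$; (3) if $G$ has exactly two heavy vertices, say $x$ and $y$, then $xy\in E(G)$ and $xy$ is a cut edge of $G$, $n$ is even and both components of $G-xy$ have $n/2$ vertices, $x$ is adjacent to every other vertex of the component of $G-xy$ which contains $x$, and $y$ is adjacent to every other vertex of the component of $G-xy$ which contains $y$. Briefly stated, $T_1\subseteq G\subseteq T_2$.
   Context: All graphs are finite and simple. Let $G$ be a graph on $n$ vertices. A vertex $v$ of $G$ is called heavy if its degree satisfies $d(v)\geq n/2$. A cycle $C$ of $G$ is called heavy if $C$ contains all heavy vertices of $G$ (in particular, if $G$ has no heavy vertices then every cycle of $G$ is heavy). For a vertex $x$, $G-x$ is the graph obtained from $G$ by deleting $x$; for an edge $e=xy$, $G-xy$ is the graph obtained from $G$ by deleting the edge $e$ (keeping its endpoints). For even $n$, $T_1$ is the graph on $n$ vertices $x,x_1,\dots,x_{n/2-1},y,y_1,\dots,y_{n/2-1}$ whose edges are $xy$, all $xx_i$ and all $yy_i$ ($1\le i\le n/2-1$); $T_2$ is the graph on the same vertex set whose edges are $xy$ together with all edges within $\{x,x_1,\dots,x_{n/2-1}\}$ and all edges within $\{y,y_1,\dots,y_{n/2-1}\}$ (two disjoint complete graphs $K_{n/2}$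 joined by the edge $xy$). The inclusion $T_1\subseteq G\subseteq T_2$ means subgraph inclusion for a suitable labelling of the vertices of $G$ other than $x,y$. -}

module Defs where

open import Data.Nat.Base using (ℕ; suc; pred; _*_; _≤_; _<_)
open import Data.Nat.Properties using (_≤?_)
open import Data.Fin.Base using (Fin; zero; suc; punchIn)
open import Data.Fin.Properties using (_≟_)
open import Data.Fin.Subset using (Subset)
  renaming (_∈_ to _∈ˢ_)
open import Data.List.Base using (List; _∷_; _∷ʳ_; length)
open import Data.List.Membership.Propositional using (_∈_)
open import Data.List.Relation.Unary.Linked using (Linked)
open import Data.List.Relation.Unary.Unique.Propositional using (Unique)
open import Data.Product.Base using (_×_; _,_; ∃; ∃₂; Σ)
open import Data.Sum.Base using (_⊎_; inj₁; inj₂; swap)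
open import Data.Vec.Base using (allFin; count)
open import Function.Base using (_∘_)
open import Function.Bundles using (_⇔_)
open import Relation.Binary.Construct.Closure.ReflexiveTransitive using (Star)
open import Relation.Binary.Definitions using (Decidable; Irreflexive; Symmetric)
open import Relation.Binary.PropositionalEquality using (_≡_; _≢_; refl; sym)
open import Relation.Nullary using (¬_)
open import Relation.Nullary.Decidable using (_×-dec_; _⊎-dec_; ¬?)
import Relation.Unary as U

record Graph (V : Set) : Set₁ where
  field
    Adj    : V → V → Set
    adj?   : Decidable Adj
    symm   : Symmetric Adj
    irrefl : Irreflexive _≡_ Adj

open Graph public

private
  variable
    n   : ℕ
    V W : Set

-- H is a subgraph of K once its vertices are relabelled along f.
_⊆[_]_ : Graph V → (V → W) → Graph W → Set
H ⊆[ f ] K = ∀ u v → Adj H u v → Adj K (f u) (f v)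

Reachable : Graph V → V → V → Set
Reachable G = Star (Adj G)

Connected : Graph V → Set
Connected {V} G = V × (∀ u v → Reachable G u v)

record Cycle {V : Set} (G : Graph V) : Set where
  field
    start    : V
    rest     : List V
    distinct : Unique (start ∷ rest)
    long     : 3 ≤ length (start ∷ rest)
    closed   : Linked (Adj G) ((start ∷ rest) ∷ʳ start)

  vertices : List V
  vertices = start ∷ rest

open Cycle public using (vertices)

IsTree : Graph V → Set
IsTree G = Connected G × ¬ Cycle G

degree : Graph (Fin n) → Fin n → ℕ
degree {n} G v = count (adj? G v) (allFin n)

-- d(v) ≥ n/2 is written without division, since n/2 need not be an integer.
Heavy : Graph (Fin n) → Fin n → Set
Heavy {n} G v = n ≤ 2 * degree G v

heavy? : (G : Graph (Fin n)) → U.Decidable (Heavy G)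
heavy? {n} G v = n ≤? 2 * degree G v

heavyCount : Graph (Fin n) → ℕ
heavyCount {n} G = count (heavy? G) (allFin n)

HeavyCycle : Graph (Fin n) → Set
HeavyCycle G = Σ (Cycle G) λ C → ∀ v → Heavy G v → v ∈ vertices C

-- A component is represented by its vertex set.
IsComponent : Graph (Fin n) → Subset n → Set
IsComponent G C = ∃ λ u → ∀ v → v ∈ˢ C ⇔ Reachable G u v

ComponentCount : Graph (Fin n) → ℕ → Set
ComponentCount {n} G k = ∃ λ (Cs : List (Subset n)) →
  Unique Cs × (∀ C → C ∈ Cs ⇔ IsComponent G C) × length Cs ≡ k

-- The vertex of G corresponding to a vertex of G - x.
restore : Fin n → Fin (pred n) → Fin n
restore {suc n} = punchIn

deleteVertex : Graph (Fin n) → Fin n → Graph (Fin (pred n))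
deleteVertex G x = record
  { Adj    = λ u v → Adj G (restore x u) (restore x v)
  ; adj?   = λ u v → adj? G (restore x u) (restore x v)
  ; symm   = symm G
  ; irrefl = λ { refl → irrefl G refl }
  }

SameEdge : V → V → V → V → Set
SameEdge x y u v = (u ≡ x × v ≡ y) ⊎ (u ≡ y × v ≡ x)

deleteEdge : Graph (Fin n) → Fin n → Fin n → Graph (Fin n)
deleteEdge G x y = record
  { Adj    = λ u v → Adj G u v × ¬ SameEdge x y u v
  ; adj?   = λ u v → adj? G u v ×-dec
                     ¬? ((u ≟ x ×-dec v ≟ y) ⊎-dec (u ≟ y ×-dec v ≟ x))
  ; symm   = λ (a , ¬e) → symm G a , ¬e ∘ flipEdge
  ; irrefl = λ { refl (a , _) → irrefl G refl a }
  }
  where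
  flipEdge : ∀ {u v} → SameEdge x y v u → SameEdge x y u v
  flipEdge (inj₁ (p , q)) = inj₂ (q , p)
  flipEdge (inj₂ (p , q)) = inj₁ (q , p)

IsCutEdge : Graph (Fin n) → Fin n → Fin n → Set
IsCutEdge G x y = Adj G x y ×
  ∃₂ λ j k → ComponentCount G j × ComponentCount (deleteEdge G x y) k × j < k

-- Vertices of T₁ and T₂, with m = n/2 - 1: x and y are the two copies of zero,
-- and x_i, y_i (1 ≤ i ≤ m) are the other elements of each copy of Fin (suc m).
Label : ℕ → Set
Label m = Fin (suc m) ⊎ Fin (suc m)

xLabel yLabel : ∀ {m} → Label m
xLabel = inj₁ zero
yLabel = inj₂ zero

-- Two disjoint copies of H joined by the edge xy.
joined : ∀ {m} → Graph (Fin (suc m)) → Graph (Label m)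
joined {m} H = record { Adj = E ; adj? = E? ; symm = λ {u} {v} → E-sym u v ; irrefl = E-irrefl }
  where
  E : Label m → Label m → Set
  E (inj₁ i) (inj₁ j) = Adj H i j
  E (inj₂ i) (inj₂ j) = Adj H i j
  E (inj₁ i) (inj₂ j) = i ≡ zero × j ≡ zero
  E (inj₂ i) (inj₁ j) = i ≡ zero × j ≡ zero

  E? : Decidable E
  E? (inj₁ i) (inj₁ j) = adj? H i j
  E? (inj₂ i) (inj₂ j) = adj? H i j
  E? (inj₁ i) (inj₂ j) = i ≟ zero ×-dec j ≟ zero
  E? (inj₂ i) (inj₁ j) = i ≟ zero ×-dec j ≟ zero

  E-sym : ∀ u v → E u v → E v u
  E-sym (inj₁ i) (inj₁ j) a       = symm H a
  E-sym (inj₂ i) (inj₂ j) a       = symm H a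
  E-sym (inj₁ i) (inj₂ j) (p , q) = q , p
  E-sym (inj₂ i) (inj₁ j) (p , q) = q , p

  E-irrefl : Irreflexive _≡_ E
  E-irrefl {inj₁ i} refl = irrefl H refl
  E-irrefl {inj₂ i} refl = irrefl H refl

starGraph : ∀ m → Graph (Fin (suc m))
starGraph m = record
  { Adj    = λ i j → (i ≡ zero × j ≢ zero) ⊎ (j ≡ zero × i ≢ zero)
  ; adj?   = λ i j → (i ≟ zero ×-dec ¬? (j ≟ zero)) ⊎-dec (j ≟ zero ×-dec ¬? (i ≟ zero))
  ; symm   = swap
  ; irrefl = λ { refl (inj₁ (p , q)) → q p ; refl (inj₂ (p , q)) → q p }
  }

completeGraph : ∀ m → Graph (Fin (suc m))
completeGraph m = record
  { Adj    = _≢_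
  ; adj?   = λ i j → ¬? (i ≟ j)
  ; symm   = λ i≢j → i≢j ∘ sym
  ; irrefl = λ i≡j i≢j → i≢j i≡j
  }

T₁ T₂ : ∀ m → Graph (Label m)
T₁ m = joined (starGraph m)
T₂ m = joined (completeGraph m)

{-# OPTIONS --safe #-}
module Submission where

-- Arrange the heavy vertices (three or more) in a cyclic order and allow "jumps" between
-- heavy vertices that need not be adjacent.  A jump between nonadjacent u and v can be
-- removed without losing a vertex: cut the cycle open there to a path from u to v.  If u
-- and v have a common neighbour off the path, close up through it; otherwise
-- d(u) + d(v) ≥ n forces, as in the Bondy–Chvátal closure, consecutive p, q on the path
-- with v ~ p and u ~ q, and the path closes up along these two edges.  Removing all jumps
-- gives a heavy cycle, so without heavy cycles at most two vertices are heavy.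
--
-- If x is the only heavy vertex then no cycle passes through x, so no two neighbours of x
-- lie in one component of G - x.  If x and y are the heavy vertices, a triangle or 4-cycle
-- through both is excluded; comparing d(x) + d(y) ≥ n with the number of vertices then
-- shows that x ~ y and that every other vertex is adjacent to exactly one of x and y.

open import Data.Bool.Base using (true; false)
import Data.Bool.Properties as Bool
open import Data.Empty using (⊥-elim)
open import Data.Fin.Base as Fin using (Fin; zero; suc; punchIn; punchOut)
open import Data.Fin.Properties using (any?; _≟_; punchIn-injective; punchInᵢ≢i; punchIn-punchOut)
open import Data.Fin.Subset using (Subset; inside; _∈_; ∣_∣)
open import Data.Fin.Subset.Properties using (⊆-antisym)
open import Data.List.Base as List using (List; []; _∷_; _∷ʳ_; _++_; length; filter; map; allFin)
open import Data.List.Membership.Propositional renaming (_∈_ to _∈ₗ_; _∉_ to _∉ₗ_) using ()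
open import Data.List.Membership.Propositional.Properties
  using (∈-filter⁺; ∈-filter⁻; ∈-++⁺ˡ; ∈-++⁺ʳ; ∈-allFin; ∈-map⁺; ∈-map⁻; ∈-lookup)
open import Data.List.Membership.Propositional.Properties.WithK using (unique∧set⇒bag)
open import Data.List.Properties
  using (length-++; filter-++; filter-accept; filter-reject; length-filter; length-map; length-tabulate)
open import Data.List.Relation.Binary.BagAndSetEquality using (∼bag⇒↭)
open import Data.List.Relation.Binary.Permutation.Propositional
  using (_↭_; ↭-sym; ↭-trans; ↭-refl; ↭-reflexive; prep; ↭⇒↭ₛ)
open import Data.List.Relation.Binary.Permutation.Propositional.Properties
  using (↭-length; filter-↭; ∈-resp-↭; ∷↭∷ʳ; ++-comm; ++⁺ˡ)
import Data.List.Relation.Binary.Permutation.Setoid.Properties as PermutationSetoid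
open import Data.List.Relation.Unary.All as All using (All; []; _∷_)
open import Data.List.Relation.Unary.All.Properties using (all-filter)
open import Data.List.Relation.Unary.AllPairs using ([]; _∷_)
open import Data.List.Relation.Unary.Any as Any using (here; there)
open import Data.List.Relation.Unary.Any.Properties using (lookup-index)
open import Data.List.Relation.Unary.Linked using (Linked; [-]; _∷_)
open import Data.List.Relation.Unary.Unique.Propositional using (Unique)
import Data.List.Relation.Unary.Unique.Propositional.Properties as Unique
open import Data.Nat.Base using (ℕ; zero; suc; _+_; _*_; _≤_; _<_; z≤n; s≤s; _/_)
open import Data.Nat.Divisibility using (_∣_; divides)
open import Data.Nat.DivMod using (m*n/n≡m)
open import Data.Nat.Properties hiding (_≟_)
open import Data.Nat.Tactic.RingSolver using (solve-∀)
open import Data.Product using (_×_; _,_; ∃; ∃₂; ∃!; Σ; proj₁; proj₂; swap)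
open import Data.Sum.Base using (_⊎_; inj₁; inj₂)
import Data.Sum.Base as Sum
import Data.Vec.Base as Vec
open import Data.Vec.Properties using (tabulate∘lookup; lookup∘tabulate; []=⇒lookup; lookup⇒[]=)
open import Function.Base using (_∘_; id)
open import Function.Bundles using (_↔_; _⇔_; mk⇔; mk↔ₛ′; Equivalence; Inverse)
open import Relation.Binary.Construct.Closure.ReflexiveTransitive using (Star; ε; _◅_; _◅◅_; gmap)
  renaming (reverse to reverse⋆)
open import Relation.Binary.PropositionalEquality
  using (_≡_; _≢_; refl; sym; trans; cong; cong₂; subst; subst₂; setoid; ≢-sym)
open import Relation.Nullary using (¬_; Dec; yes; no; contradiction; does)
open import Relation.Nullary.Decidable using (_×-dec_; _⊎-dec_; ¬?; dec-true; decidable-stable)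
open import Relation.Unary using (Decidable)
open import Defs

private
  variable
    A B : Set
    P Q : A → Set
    n : ℕ
    xs ys : List A

-- Counting in lists and subsets

Unique-resp-↭ : xs ↭ ys → Unique xs → Unique ys
Unique-resp-↭ = PermutationSetoid.Unique-resp-↭ (setoid _) ∘ ↭⇒↭ₛ

unique∧same⇒↭ : Unique xs → Unique ys → (∀ v → v ∈ₗ xs → v ∈ₗ ys) → (∀ v → v ∈ₗ ys → v ∈ₗ xs) → xs ↭ ys
unique∧same⇒↭ u u′ f g = ∼bag⇒↭ (unique∧set⇒bag u u′ (mk⇔ (f _) (g _)))

module _ {P : A → Set} (P? : Decidable P) where

  # : List A → ℕ
  # xs = length (filter P? xs)

  #-++ : ∀ xs ys → # (xs ++ ys) ≡ # xs + # ys
  #-++ xs ys = trans (cong length (filter-++ P? xs ys)) (length-++ (filter P? xs))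

  #-↭ : xs ↭ ys → # xs ≡ # ys
  #-↭ p = ↭-length (filter-↭ P? p)

  #-accept : ∀ {x xs} → P x → # (x ∷ xs) ≡ suc (# xs)
  #-accept = cong length ∘ filter-accept P?

  #-reject : ∀ {x xs} → ¬ P x → # (x ∷ xs) ≡ # xs
  #-reject = cong length ∘ filter-reject P?

indicator : Dec B → ℕ
indicator (yes _) = 1
indicator (no  _) = 0

indicator-no : (b? : Dec B) → ¬ B → indicator b? ≡ 0
indicator-no (yes b) ¬b = contradiction b ¬b
indicator-no (no _)  _  = refl

#-∷ : (P? : Decidable P) → ∀ x xs → # P? (x ∷ xs) ≡ indicator (P? x) + # P? xs
#-∷ P? x xs with P? x
... | yes _ = refl
... | no  _ = refl

indicator-exclusive : (a? : Dec A) (b? : Dec B) → ¬ (A × B) → indicator a? + indicator b? ≤ 1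
indicator-exclusive (yes a) (yes b) ¬ab = contradiction (a , b) ¬ab
indicator-exclusive (yes _) (no  _) _   = ≤-refl
indicator-exclusive (no  _) (yes _) _   = ≤-refl
indicator-exclusive (no  _) (no  _) _   = z≤n

#-exclusive : (P? : Decidable P) (Q? : Decidable Q) → ∀ xs → (∀ v → v ∈ₗ xs → ¬ (P v × Q v)) →
              # P? xs + # Q? xs ≤ length xs
#-exclusive P? Q? []       _  = z≤n
#-exclusive P? Q? (x ∷ xs) ex rewrite #-∷ P? x xs | #-∷ Q? x xs = begin
  (p + # P? xs) + (q + # Q? xs) ≡⟨ interchange p (# P? xs) q (# Q? xs) ⟩
  (p + q) + (# P? xs + # Q? xs)
    ≤⟨ +-mono-≤ (indicator-exclusive (P? x) (Q? x) (ex x (here refl)))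
                (#-exclusive P? Q? xs (λ v → ex v ∘ there)) ⟩
  suc (length xs)               ∎
  where
  open ≤-Reasoning
  p = indicator (P? x)
  q = indicator (Q? x)
  interchange : ∀ a b c d → (a + b) + (c + d) ≡ (a + c) + (b + d)
  interchange = solve-∀

-- Two predicates and two functions are allowed because `∣_∣` counts entries of a Boolean vector,
-- while `∣C∣≡length` needs a count of indices.
count-tabulate : ∀ {n} (P? : Decidable P) (Q? : Decidable Q) (f : Fin n → A) (g : Fin n → B) →
                 (∀ i → does (P? (f i)) ≡ does (Q? (g i))) →
                 Vec.count P? (Vec.tabulate f) ≡ # Q? (List.tabulate g)
count-tabulate {n = zero}  P? Q? f g same = refl
count-tabulate {n = suc n} P? Q? f g same
  with does (P? (f zero)) | does (Q? (g zero)) | same zero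
... | true  | _ | refl = cong suc (count-tabulate P? Q? (f ∘ suc) (g ∘ suc) (same ∘ suc))
... | false | _ | refl = count-tabulate P? Q? (f ∘ suc) (g ∘ suc) (same ∘ suc)

count-allFin : ∀ {n} {P : Fin n → Set} (P? : Decidable P) → Vec.count P? (Vec.allFin n) ≡ # P? (allFin n)
count-allFin P? = count-tabulate P? P? id id (λ _ → refl)

∣C∣≡length : (C : Subset n) (xs : List (Fin n)) → Unique xs → (∀ v → v ∈ C ⇔ v ∈ₗ xs) → ∣ C ∣ ≡ length xs
∣C∣≡length {n} C xs u same = begin
  ∣ C ∣                               ≡⟨ cong ∣_∣ (tabulate∘lookup C) ⟨
  ∣ Vec.tabulate (Vec.lookup C) ∣     ≡⟨ count-tabulate (Bool._≟ inside) in? (Vec.lookup C) id (λ _ → refl) ⟩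
  # in? (allFin n)                    ≡⟨ ↭-length (unique∧same⇒↭ (Unique.filter⁺ in? (Unique.allFin⁺ n)) u to from) ⟩
  length xs                           ∎
  where
  open Relation.Binary.PropositionalEquality.≡-Reasoning
  in? : Decidable (λ i → Vec.lookup C i ≡ inside)
  in? i = Vec.lookup C i Bool.≟ inside
  to : ∀ v → v ∈ₗ filter in? (allFin n) → v ∈ₗ xs
  to v v∈ = Equivalence.to (same v) (lookup⇒[]= v C (proj₂ (∈-filter⁻ in? {xs = allFin n} v∈)))
  from : ∀ v → v ∈ₗ xs → v ∈ₗ filter in? (allFin n)
  from v v∈ = ∈-filter⁺ in? (∈-allFin v) ([]=⇒lookup (Equivalence.from (same v) v∈))

-- A vertex satisfying both P and Q is counted twice on the left, and is charged to xs.
#-overlap : {P Q : Fin n → Set} (P? : Decidable P) (Q? : Decidable Q) → ∀ xs → Unique xs →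
            (∀ v → v ∉ₗ xs → ¬ (P v × Q v)) →
            # P? (allFin n) + # Q? (allFin n) + length xs ≤ n + (# P? xs + # Q? xs)
#-overlap {n} P? Q? xs u ex = begin
  # P? (allFin n) + # Q? (allFin n) + length xs
    ≡⟨ cong (_+ length xs) (cong₂ _+_ (split P?) (split Q?)) ⟩
  (# P? xs + # P? rest) + (# Q? xs + # Q? rest) + length xs
    ≡⟨ rearrange (# P? xs) (# P? rest) (# Q? xs) (# Q? rest) (length xs) ⟩
  (# P? rest + # Q? rest) + (length xs + (# P? xs + # Q? xs))
    ≤⟨ +-monoˡ-≤ _ (#-exclusive P? Q? rest (λ v v∈ → ex v (proj₂ (∈-filter⁻ out? {xs = allFin n} v∈)))) ⟩
  length rest + (length xs + (# P? xs + # Q? xs))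
    ≡⟨ rearrange′ (length rest) (length xs) (# P? xs + # Q? xs) ⟩
  (length xs + length rest) + (# P? xs + # Q? xs)
    ≡⟨ cong (_+ (# P? xs + # Q? xs)) total ⟨
  n + (# P? xs + # Q? xs) ∎
  where
  open ≤-Reasoning
  open import Data.List.Membership.DecPropositional (_≟_ {n}) using () renaming (_∈?_ to _∈ₗ?_)
  rearrange : ∀ a b c d e → (a + b) + (c + d) + e ≡ (b + d) + (e + (a + c))
  rearrange = solve-∀
  rearrange′ : ∀ a b c → a + (b + c) ≡ (b + a) + c
  rearrange′ = solve-∀
  out? : Decidable (_∉ₗ xs)
  out? v = ¬? (v ∈ₗ? xs)
  rest = filter out? (allFin n)
  perm : allFin n ↭ xs ++ rest
  perm = unique∧same⇒↭ (Unique.allFin⁺ n)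
    (Unique.++⁺ u (Unique.filter⁺ out? (Unique.allFin⁺ n))
      (λ (v∈ , v∈r) → proj₂ (∈-filter⁻ out? {xs = allFin n} v∈r) v∈))
    place (λ v _ → ∈-allFin v)
    where
    place : ∀ v → v ∈ₗ allFin n → v ∈ₗ xs ++ rest
    place v _ with v ∈ₗ? xs
    ... | yes v∈ = ∈-++⁺ˡ v∈
    ... | no  v∉ = ∈-++⁺ʳ xs (∈-filter⁺ out? (∈-allFin v) v∉)
  split : {R : Fin n → Set} (R? : Decidable R) → # R? (allFin n) ≡ # R? xs + # R? rest
  split R? = trans (#-↭ R? perm) (#-++ R? xs rest)
  total : n ≡ length xs + length rest
  total = trans (sym (length-tabulate id)) (trans (↭-length perm) (length-++ xs))

-- Paths with jumps and the removal of jumps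

-- From u to w through the vertices of l, the last of which is w; the index k counts
-- the jumps, i.e. the consecutive pairs that need not be adjacent but are both heavy.
data Path (G : Graph (Fin n)) : ℕ → Fin n → List (Fin n) → Fin n → Set where
  stop : ∀ {u} → Path G 0 u [] u
  step : ∀ {k u v l w} → Adj G u v → Path G k v l w → Path G k u (v ∷ l) w
  jump : ∀ {k u v l w} → Heavy G u × Heavy G v → Path G k v l w → Path G (suc k) u (v ∷ l) w

module _ {n : ℕ} {G : Graph (Fin n)} where

  private
    variable
      i j k : ℕ
      u v w z : Fin n
      l m : List (Fin n)

  joinByEdge : Path G j u l v → Adj G v w → Path G k w m z → Path G (j + k) u (l ++ w ∷ m) z
  joinByEdge stop       a q = step a q
  joinByEdge (step b p) a q = step b (joinByEdge p a q)
  joinByEdge (jump h p) a q = jump h (joinByEdge p a q)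

  joinByJump : Path G j u l v → Heavy G v × Heavy G w → Path G k w m z →
               Path G (suc (j + k)) u (l ++ w ∷ m) z
  joinByJump stop       h q = jump h q
  joinByJump (step b p) h q = step b (joinByJump p h q)
  joinByJump (jump g p) h q = jump g (joinByJump p h q)

  private
    drop+0 : Path G (k + 0) u l v → Path G k u l v
    drop+0 = subst (λ i → Path G i _ _ _) (+-identityʳ _)

  reversePath : Path G k u l v → ∃ λ m → Path G k v m u × v ∷ m ↭ u ∷ l
  reversePath stop = [] , stop , ↭-refl
  reversePath {u = u} (step a p) with m , q , perm ← reversePath p =
    m ∷ʳ u , drop+0 (joinByEdge q (symm G a) stop) ,
    ↭-trans (↭-sym (∷↭∷ʳ u _)) (prep u perm)
  reversePath {u = u} (jump (h , h′) p) with m , q , perm ← reversePath p =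
    m ∷ʳ u , drop+0 {k = suc _} (joinByJump q (h′ , h) stop) ,
    ↭-trans (↭-sym (∷↭∷ʳ u _)) (prep u perm)

  path-linked : Path G 0 u l v → Adj G v w → Linked (Adj G) (u ∷ l ∷ʳ w)
  path-linked stop       b = b ∷ [-]
  path-linked (step a p) b = a ∷ path-linked p b

  close : Path G 0 u l v → Adj G v u → Unique (u ∷ l) → 3 ≤ length (u ∷ l) → Cycle G
  close {u = u} {l = l} p a unique long = record
    { start = u ; rest = l ; distinct = unique ; long = long ; closed = path-linked p a }

  -- The pair `p`, `q` where the path is cut may be an edge or a jump, so the jumps of the two
  -- halves are only bounded by `k`.
  record Split (k : ℕ) (u : Fin n) (l : List (Fin n)) (v : Fin n) (R : Fin n → Fin n → Set) : Set where
    field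
      {c d}   : ℕ
      {p q}   : Fin n
      {l₁ l₂} : List (Fin n)
      before  : Path G c u l₁ p
      after   : Path G d q l₂ v
      cut     : R p q
      list    : l ≡ l₁ ++ q ∷ l₂
      bound   : c + d ≤ k

  split-step : ∀ {R} → Adj G u w → Split k w l v R → Split k u (w ∷ l) v R
  split-step a s = record { before = step a before ; after = after ; cut = cut
                                ; list = cong (_ ∷_) list ; bound = bound }
    where open Split s

  split-jump : ∀ {R} → Heavy G u × Heavy G w → Split k w l v R → Split (suc k) u (w ∷ l) v R
  split-jump h s = record { before = jump h before ; after = after ; cut = cut
                                ; list = cong (_ ∷_) list ; bound = s≤s bound }
    where open Split s

  split-at-jump : Path G (suc k) u l v → Split k u l v (λ p q → Heavy G p × Heavy G q)
  split-at-jump (step a p) = split-step a (split-at-jump p)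
  split-at-jump (jump h p) = record { before = stop ; after = p ; cut = h ; list = refl ; bound = ≤-refl }

  module _ {P Q : Fin n → Set} (P? : Decidable P) (Q? : Decidable Q) where

    -- `Q?` is charged to the first member of each consecutive pair and `P?` to the second, so the
    -- new pair `u`, `w` costs at most one. The slack `e` is reserved for the last vertex of the
    -- path, which begins no pair.
    count-step : ∀ {e} → ¬ (Q u × P w) → # P? l + # Q? (w ∷ l) ≤ length l + e →
                 # P? (w ∷ l) + # Q? (u ∷ w ∷ l) ≤ suc (length l) + e
    count-step {u} {w} {l} {e} ¬c le rewrite #-∷ P? w l | #-∷ Q? u (w ∷ l) = begin
      (pw + # P? l) + (qu + # Q? (w ∷ l)) ≡⟨ interchange pw (# P? l) qu (# Q? (w ∷ l)) ⟩
      (qu + pw) + (# P? l + # Q? (w ∷ l)) ≤⟨ +-mono-≤ (indicator-exclusive (Q? u) (P? w) ¬c) le ⟩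
      suc (length l) + e                  ∎
      where
      open ≤-Reasoning
      pw = indicator (P? w)
      qu = indicator (Q? u)
      interchange : ∀ a b c d → (a + b) + (c + d) ≡ (c + a) + (b + d)
      interchange = solve-∀

    -- Crossing edges: if no consecutive p, q on the path satisfy Q p and P q, then every
    -- consecutive pair contributes at most one to the two counts.
    split-or-count : Path G k u l v →
      Split k u l v (λ p q → Q p × P q) ⊎ # P? l + # Q? (u ∷ l) ≤ length l + indicator (Q? v)
    split-or-count stop = inj₂ (≤-reflexive (trans (#-∷ Q? _ []) (+-identityʳ _)))
    split-or-count (step {u = u} {v = w} a p) with Q? u ×-dec P? w
    ... | yes c = inj₁ (record { before = stop ; after = p ; cut = c ; list = refl ; bound = ≤-refl })
    ... | no ¬c = Sum.map (split-step a) (count-step ¬c) (split-or-count p)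
    split-or-count (jump {u = u} {v = w} h p) with Q? u ×-dec P? w
    ... | yes c = inj₁ (record { before = stop ; after = p ; cut = c ; list = refl ; bound = n≤1+n _ })
    ... | no ¬c = Sum.map (split-jump h) (count-step ¬c) (split-or-count p)

  open import Data.List.Membership.DecPropositional (_≟_ {n}) using () renaming (_∈?_ to _∈ₗ?_)

  Spanning : List (Fin n) → Set
  Spanning l = Unique l × 3 ≤ length l × (∀ v → Heavy G v → v ∈ₗ l)

  spanning-↭ : l ↭ m → Spanning l → Spanning m
  spanning-↭ perm (unique , long , covers) =
    Unique-resp-↭ perm unique , subst (3 ≤_) (↭-length perm) long , λ v → ∈-resp-↭ perm ∘ covers v

  spanning-∷ : w ∉ₗ l → Spanning l → Spanning (w ∷ l)
  spanning-∷ w∉ (unique , long , covers) =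
    All.tabulate (λ { x∈ refl → w∉ x∈ }) ∷ unique , m≤n⇒m≤1+n long , λ v → there ∘ covers v

  -- A cyclic arrangement read from a place where the closing pair is an edge. The number of jumps
  -- is only bounded because a crossing may cut the path at a jump and so discard a further one.
  record Ring (k : ℕ) : Set where
    field
      {jumps}  : ℕ
      {s t}    : Fin n
      {inner}  : List (Fin n)
      path     : Path G jumps s inner t
      closing  : Adj G t s
      spanning : Spanning (s ∷ inner)
      bound    : jumps ≤ k

  degree≡# : ∀ v → degree G v ≡ # (adj? G v) (allFin n)
  degree≡# v = count-allFin (adj? G v)

  heavy-sum : Heavy G u → Heavy G v → n ≤ # (adj? G u) (allFin n) + # (adj? G v) (allFin n)
  heavy-sum {u} {v} hu hv rewrite sym (degree≡# u) | sym (degree≡# v) = *-cancelˡ-≤ 2 (begin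
    2 * n                           ≡⟨ cong (n +_) (+-identityʳ n) ⟩
    n + n                           ≤⟨ +-mono-≤ hu hv ⟩
    2 * degree G u + 2 * degree G v ≡⟨ *-distribˡ-+ 2 (degree G u) _ ⟨
    2 * (degree G u + degree G v)   ∎)
    where open ≤-Reasoning

  -- Off `l` every vertex is adjacent to at most one of `u` and `v`. The two degrees add up to at
  -- least `n`, so at least `length l` of this sum comes from inside `l`.
  heavy-pair-count : Heavy G u → Heavy G v → Unique l → (∀ w → w ∉ₗ l → ¬ (Adj G u w × Adj G v w)) →
                     length l ≤ # (adj? G u) l + # (adj? G v) l
  heavy-pair-count {u} {v} {l} hu hv unique ¬common = +-cancelˡ-≤ n _ _ (begin
    n + length l
      ≤⟨ +-monoˡ-≤ _ (heavy-sum hu hv) ⟩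
    # (adj? G u) (allFin n) + # (adj? G v) (allFin n) + length l
      ≤⟨ #-overlap (adj? G u) (adj? G v) l unique ¬common ⟩
    n + (# (adj? G u) l + # (adj? G v) l) ∎)
    where open ≤-Reasoning

  -- Without a crossing pair, `split-or-count` bounds the neighbours on the path by `length l`, one
  -- less than `heavy-pair-count` requires.
  crossing : Path G k u l v → Heavy G u → Heavy G v → Unique (u ∷ l) →
             (∀ w → w ∉ₗ u ∷ l → ¬ (Adj G u w × Adj G v w)) →
             Split k u l v (λ p q → Adj G v p × Adj G u q)
  crossing {k} {u} {l} {v} p hu hv unique ¬common with split-or-count (adj? G u) (adj? G v) p
  ... | inj₁ s   = s
  ... | inj₂ few = contradiction excess (<⇒≱ (n<1+n _))
    where
    open ≤-Reasoning
    V = # (adj? G v) (u ∷ l)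
    excess : length (u ∷ l) ≤ length l
    excess = begin
      length (u ∷ l)                      ≤⟨ heavy-pair-count hu hv unique ¬common ⟩
      -- The decisive unit is gained here and two lines below: neither `u` nor `v` is its own
      -- neighbour.
      # (adj? G u) (u ∷ l) + V            ≡⟨ cong (_+ V) (#-reject (adj? G u) (irrefl G refl)) ⟩
      # (adj? G u) l + V                  ≤⟨ few ⟩
      length l + indicator (adj? G v v)   ≡⟨ cong (length l +_) (indicator-no (adj? G v v) (irrefl G refl)) ⟩
      length l + 0                        ≡⟨ +-identityʳ _ ⟩
      length l                            ∎

  -- All three ways of closing up use edges only, so the number of jumps does not grow.
  close-heavy-path : Path G k u l v → Heavy G u → Heavy G v → Spanning (u ∷ l) → Ring k
  close-heavy-path {k} {u} {l} {v} p hu hv spanning@(unique , _)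
    with adj? G v u | any? (λ w → ¬? (w ∈ₗ? (u ∷ l)) ×-dec (adj? G u w ×-dec adj? G v w))
  ... | yes a | _ = record { path = p ; closing = a ; spanning = spanning ; bound = ≤-refl }
  ... | no _  | yes (w , w∉ , uw , vw) = record
    { path     = joinByEdge p vw stop
    ; closing  = symm G uw
    ; spanning = spanning-↭ (∷↭∷ʳ w (u ∷ l)) (spanning-∷ w∉ spanning)
    ; bound    = ≤-reflexive (+-identityʳ k)
    }
  ... | no _  | no ¬common
    with s ← crossing p hu hv unique (λ w w∉ c → ¬common (w , w∉ , c))
    with m , after⁻¹ , perm ← reversePath (Split.after s) = record
    -- The new cycle runs from `u` to `p`, crosses to `v`, returns along the reversed second half to
    -- `q`, and closes at `u`.
    { path     = joinByEdge before (symm G (proj₁ cut)) after⁻¹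
    ; closing  = symm G (proj₂ cut)
    ; spanning = spanning-↭ (prep u (↭-trans (↭-reflexive list) (++⁺ˡ _ (↭-sym perm)))) spanning
    ; bound    = bound
    }
    where open Split s

  -- Opening the ring at a jump discards that jump and leaves a path with heavy ends, which
  -- `close-heavy-path` closes again at no cost.
  remove-jump : Ring (suc k) → Ring k
  remove-jump {k} r with Ring.jumps r ≤? k
  ... | yes j≤k = record { path = path ; closing = closing ; spanning = spanning ; bound = j≤k }
    where open Ring r
  ... | no  j≰k = reopen r (≤-antisym (Ring.bound r) (≰⇒> j≰k))
    where
    reopen : (r : Ring (suc k)) → Ring.jumps r ≡ suc k → Ring k
    -- The opened path starts at `q`, reaches `t`, passes over the closing edge to `s`, and ends at
    -- `p`.
    reopen r refl = widen (close-heavy-path (joinByEdge after closing before) (proj₂ cut) (proj₁ cut)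
                            (spanning-↭ (↭-trans (prep s (↭-reflexive list)) (++-comm (s ∷ l₁) (q ∷ l₂))) spanning))
      where
      open Ring r hiding (bound)
      open Split (split-at-jump path) using (c; d; q; l₁; l₂; before; after; cut; list) renaming (bound to c+d≤k)
      widen : Ring (d + c) → Ring k
      widen r′ = record { path = Ring.path r′ ; closing = Ring.closing r′ ; spanning = Ring.spanning r′
                        ; bound = ≤-trans (Ring.bound r′) (≤-trans (≤-reflexive (+-comm d c)) c+d≤k) }

  ring⇒cycle : ∀ k → Ring k → HeavyCycle G
  ring⇒cycle zero    record { path = p ; closing = a ; spanning = unique , long , covers ; bound = z≤n } =
    close p a unique long , covers
  ring⇒cycle (suc k) r = ring⇒cycle k (remove-jump r)

  -- The starting configuration: heavy vertices in any order, with every consecutive pair a jump.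
  -- The last vertex is returned as heavy so that the path can be closed.
  jump-path : ∀ u l → Heavy G u → All (Heavy G) l → ∃₂ λ k v → Path G k u l v × Heavy G v
  jump-path u []      hu []        = 0 , u , stop , hu
  jump-path u (v ∷ l) hu (hv ∷ hl) with k , w , p , hw ← jump-path v l hv hl =
    suc k , w , jump (hu , hv) p , hw

  heavyCount≤2 : ¬ HeavyCycle G → heavyCount G ≤ 2
  heavyCount≤2 ¬cycle = subst (_≤ 2) (sym (count-allFin (heavy? G))) (few heavies unique all-heavy covers)
    where
    heavies = filter (heavy? G) (allFin n)
    unique = Unique.filter⁺ (heavy? G) (Unique.allFin⁺ n)
    all-heavy : All (Heavy G) heavies
    all-heavy = all-filter (heavy? G) (allFin n)
    covers : ∀ v → Heavy G v → v ∈ₗ heavies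
    covers v = ∈-filter⁺ (heavy? G) (∈-allFin v)
    few : ∀ l → Unique l → All (Heavy G) l → (∀ v → Heavy G v → v ∈ₗ l) → length l ≤ 2
    few []                _ _ _ = z≤n
    few (_ ∷ [])          _ _ _ = s≤s z≤n
    few (_ ∷ _ ∷ [])      _ _ _ = s≤s (s≤s z≤n)
    -- Three heavy vertices meet the minimal length of a cycle, and the list covers all heavy
    -- vertices, so the closed path of jumps becomes a heavy cycle.
    few (u ∷ l@(_ ∷ _ ∷ _)) unique (hu ∷ hl) covers
      with k , v , p , hv ← jump-path u l hu hl =
      contradiction (ring⇒cycle k (close-heavy-path p hu hv (unique , s≤s (s≤s (s≤s z≤n)) , covers))) ¬cycle

-- Components through representatives

-- Two vertices are mutually reachable exactly when `rep` agrees on them: `rep-adj` gives one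
-- direction, `toRep` the other. Components can thus be listed as fibres of `rep`, both for the
-- whole graph and after a deletion.
module Representatives {n : ℕ} (G : Graph (Fin n)) (rep : Fin n → Fin n) (reps : List (Fin n))
  (rep∈reps  : ∀ v → rep v ∈ₗ reps)
  (rep-fixes : ∀ {r} → r ∈ₗ reps → rep r ≡ r)
  (toRep     : ∀ v → Reachable G v (rep v))
  (rep-adj   : ∀ {u v} → Adj G u v → rep u ≡ rep v)
  where

  rep-reachable : ∀ {u v} → Reachable G u v → rep u ≡ rep v
  rep-reachable ε       = refl
  rep-reachable (a ◅ w) = trans (rep-adj a) (rep-reachable w)

  same-rep⇒reachable : ∀ {u v} → rep u ≡ rep v → Reachable G u v
  same-rep⇒reachable {u} {v} eq =
    subst (Reachable G u) eq (toRep u) ◅◅ reverse⋆ (symm G) (toRep v)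

  component : Fin n → Subset n
  component r = Vec.tabulate (λ v → does (rep v ≟ r))

  ∈-component⁻ : ∀ {v r} → v ∈ component r → rep v ≡ r
  ∈-component⁻ {v} {r} v∈ with rep v ≟ r | trans (sym (lookup∘tabulate _ v)) ([]=⇒lookup v∈)
  ... | yes eq | _ = eq
  ... | no  _  | ()

  ∈-component⁺ : ∀ {v r} → rep v ≡ r → v ∈ component r
  ∈-component⁺ {v} {r} eq = lookup⇒[]= v _ (trans (lookup∘tabulate _ v) (dec-true (rep v ≟ r) eq))

  isComponent : ∀ {r} → r ∈ₗ reps → IsComponent G (component r)
  isComponent {r} r∈ = r , λ v → mk⇔
    (λ v∈ → same-rep⇒reachable (trans (rep-fixes r∈) (sym (∈-component⁻ v∈))))
    (λ w → ∈-component⁺ (trans (sym (rep-reachable w)) (rep-fixes r∈)))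

  isComponent⇒≡ : ∀ {C} → ((u , _) : IsComponent G C) → C ≡ component (rep u)
  isComponent⇒≡ (u , members) = ⊆-antisym
    (λ {v} v∈ → ∈-component⁺ (sym (rep-reachable (Equivalence.to (members v) v∈))))
    (λ {v} v∈ → Equivalence.from (members v) (same-rep⇒reachable (sym (∈-component⁻ v∈))))

  -- As `rep` fixes `r`, the vertex `r` lies in `component r` and in no `component s` with `s`
  -- different from `r`. The induction shrinks `rs` while `reps` stays fixed.
  unique-components : ∀ {rs} → (∀ {r} → r ∈ₗ rs → r ∈ₗ reps) → Unique rs → Unique (map component rs)
  unique-components _    []         = []
  unique-components ⊆reps (r∉ ∷ u) = All.tabulate different ∷ unique-components (⊆reps ∘ there) u
    where
    different : ∀ {C} → C ∈ₗ map component _ → component _ ≢ C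
    different C∈ eq with s , s∈ , refl ← ∈-map⁻ component C∈ =
      All.lookup r∉ s∈ (trans (sym (rep-fixes (⊆reps (here refl))))
                              (∈-component⁻ (subst (_ ∈_) eq (∈-component⁺ (rep-fixes (⊆reps (here refl)))))))

  componentCount : Unique reps → ComponentCount G (length reps)
  componentCount u = map component reps , unique-components id u , (λ C → mk⇔ to from) , length-map component reps
    where
    to : ∀ {C} → C ∈ₗ map component reps → IsComponent G C
    to C∈ with r , r∈ , refl ← ∈-map⁻ component C∈ = isComponent r∈
    from : ∀ {C} → IsComponent G C → C ∈ₗ map component reps
    from c@(u , _) = subst (_∈ₗ _) (sym (isComponent⇒≡ c)) (∈-map⁺ component (rep∈reps u))

-- Paths from walks, and the deletion of a vertex

module _ {n : ℕ} {G : Graph (Fin n)} where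

  open import Data.List.Membership.DecPropositional (_≟_ {n}) using () renaming (_∈?_ to _∈ₗ?_)

  path-suffix : ∀ {u v w l} → Path G 0 v l w → Unique (v ∷ l) → u ∈ₗ v ∷ l →
                ∃ λ m → Path G 0 u m w × Unique (u ∷ m)
  path-suffix p          unique       (here refl) = _ , p , unique
  path-suffix (step _ p) (_ ∷ unique) (there u∈)  = path-suffix p unique u∈

  -- Loop erasure: if `u` already lies on the path found for the rest of the walk, only the part of
  -- that path from `u` on is kept.
  walk⇒path : ∀ {u w} → Reachable G u w → ∃ λ l → Path G 0 u l w × Unique (u ∷ l)
  walk⇒path ε = [] , stop , [] ∷ []
  walk⇒path {u} (_◅_ {j = v} a walk) with l , p , unique ← walk⇒path walk | u ∈ₗ? (v ∷ l)
  ... | yes u∈ = path-suffix p unique u∈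
  ... | no  u∉ = v ∷ l , step a p , All.tabulate (λ { x∈ refl → u∉ x∈ }) ∷ unique

module DeleteVertex {n : ℕ} (G : Graph (Fin (suc n))) (x : Fin (suc n)) where

  G-x : Graph (Fin n)
  G-x = deleteVertex G x

  restorePath : ∀ {u l v} → Path G-x 0 u l v → Path G 0 (punchIn x u) (map (punchIn x) l) (punchIn x v)
  restorePath stop       = stop
  restorePath (step a p) = step a (restorePath p)

  -- A path from `a` to `b` avoiding `x` is closed up by the two edges at `x`; `a ≢ b` makes the
  -- cycle long enough.
  cycle-through : ∀ {a b} → a ≢ b → Adj G x (punchIn x a) → Adj G x (punchIn x b) →
                  Reachable G-x a b → Σ (Cycle G) λ C → x ∈ₗ vertices C
  cycle-through a≢b xa xb walk with walk⇒path walk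
  ... | []    , stop , _      = contradiction refl a≢b
  ... | _ ∷ _ , p    , unique =
    close (step xa (restorePath p)) (symm G xb)
          (All.tabulate x∉ ∷ Unique.map⁺ (punchIn-injective x _ _) unique) (s≤s (s≤s (s≤s z≤n))) ,
    here refl
    where
    x∉ : ∀ {v l} → v ∈ₗ map (punchIn x) l → x ≢ v
    x∉ v∈ refl with u , _ , eq ← ∈-map⁻ (punchIn x) v∈ = punchInᵢ≢i x u (sym eq)

  -- The walk is followed to its first arrival at `x`; the vertex just before is a neighbour of `x`.
  -- The equation links the vertex `v` of `G - x` with the start of a walk that lives in `G`.
  attachment : ∀ {u} v → punchIn x v ≡ u → Reachable G u x →
               ∃ λ a → Reachable G-x v a × Adj G x (punchIn x a)
  attachment v eq ε = contradiction eq (punchInᵢ≢i x v)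
  attachment v refl (_◅_ {j = w} a walk) with x ≟ w
  ... | yes refl = v , ε , symm G a
  ... | no  x≢w  with b , walk′ , xb ← attachment (punchOut x≢w) (punchIn-punchOut x≢w) walk =
    b , subst (Adj G _) (sym (punchIn-punchOut x≢w)) a ◅ walk′ , xb

  attached? : Decidable (λ v → Adj G x (punchIn x v))
  attached? v = adj? G x (punchIn x v)

  attached : List (Fin n)
  attached = filter attached? (allFin n)

  attached-unique : Unique attached
  attached-unique = Unique.filter⁺ attached? (Unique.allFin⁺ n)

  degree≡attached : degree G x ≡ length attached
  degree≡attached = begin
    degree G x                         ≡⟨ count-allFin (adj? G x) ⟩
    # (adj? G x) (allFin (suc n))      ≡⟨ ↭-length (unique∧same⇒↭ (Unique.filter⁺ (adj? G x) (Unique.allFin⁺ _))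
                                            (Unique.map⁺ (punchIn-injective x _ _) attached-unique) to from) ⟩
    length (map (punchIn x) attached)  ≡⟨ length-map (punchIn x) attached ⟩
    length attached                    ∎
    where
    open Relation.Binary.PropositionalEquality.≡-Reasoning
    to : ∀ v → v ∈ₗ filter (adj? G x) (allFin _) → v ∈ₗ map (punchIn x) attached
    to v v∈ = subst (_∈ₗ _) (punchIn-punchOut x≢v)
      (∈-map⁺ (punchIn x) (∈-filter⁺ attached? (∈-allFin _) (subst (Adj G x) (sym (punchIn-punchOut x≢v)) xv)))
      where
      xv = proj₂ (∈-filter⁻ (adj? G x) {xs = allFin _} v∈)
      x≢v : x ≢ v
      x≢v x≡v = irrefl G x≡v xv
    from : ∀ v → v ∈ₗ map (punchIn x) attached → v ∈ₗ filter (adj? G x) (allFin _)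
    from v v∈ with a , a∈ , refl ← ∈-map⁻ (punchIn x) v∈ =
      ∈-filter⁺ (adj? G x) (∈-allFin v) (proj₂ (∈-filter⁻ attached? {xs = allFin _} a∈))

  module _ (connected : Connected G) (no-cycle : ¬ Σ (Cycle G) λ C → x ∈ₗ vertices C) where

    -- The neighbours of `x` serve as representatives: connectedness puts at least one in each
    -- component of `G - x`, and a second one would give a cycle through `x`.
    rep : Fin n → Fin n
    rep v = proj₁ (attachment v refl (proj₂ connected _ x))

    toRep : ∀ v → Reachable G-x v (rep v)
    toRep v = proj₁ (proj₂ (attachment v refl (proj₂ connected _ x)))

    rep-attached : ∀ v → Adj G x (punchIn x (rep v))
    rep-attached v = proj₂ (proj₂ (attachment v refl (proj₂ connected _ x)))

    attached-unique-in-component : ∀ {a b} → Adj G x (punchIn x a) → Adj G x (punchIn x b) →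
                                   Reachable G-x a b → a ≡ b
    attached-unique-in-component {a} {b} xa xb walk with a ≟ b
    ... | yes a≡b = a≡b
    ... | no  a≢b = contradiction (cycle-through a≢b xa xb walk) no-cycle

    rep∈attached : ∀ v → rep v ∈ₗ attached
    rep∈attached v = ∈-filter⁺ attached? (∈-allFin _) (rep-attached v)

    rep-fixes : ∀ {r} → r ∈ₗ attached → rep r ≡ r
    rep-fixes {r} r∈ = attached-unique-in-component (rep-attached r)
      (proj₂ (∈-filter⁻ attached? {xs = allFin n} r∈)) (reverse⋆ (symm G-x) (toRep r))

    rep-adj : ∀ {u v} → Adj G-x u v → rep u ≡ rep v
    rep-adj {u} {v} a = attached-unique-in-component (rep-attached u) (rep-attached v)
      (reverse⋆ (symm G-x) (toRep u) ◅◅ a ◅ toRep v)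

    componentCount-degree : ComponentCount G-x (degree G x)
    componentCount-degree = subst (ComponentCount G-x) (sym degree≡attached)
      (Representatives.componentCount G-x rep attached rep∈attached rep-fixes toRep rep-adj attached-unique)

    one-attached : ∀ C → IsComponent G-x C → ∃! _≡_ λ v → v ∈ C × Adj G x (punchIn x v)
    one-attached C (u , members) =
      rep u , (Equivalence.from (members _) (toRep u) , rep-attached u) ,
      λ {v} (v∈ , xv) → attached-unique-in-component (rep-attached u) xv
        (reverse⋆ (symm G-x) (toRep u) ◅◅ Equivalence.to (members v) v∈)

-- Enumerations and the bijections built from them

lookup-injective : Unique xs → ∀ {i j} → List.lookup xs i ≡ List.lookup xs j → i ≡ j
lookup-injective (_ ∷ _)  {zero}  {zero}  _  = refl
lookup-injective (x∉ ∷ _) {zero}  {suc j} eq = contradiction eq (All.lookup x∉ (∈-lookup j))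
lookup-injective (x∉ ∷ _) {suc i} {zero}  eq = contradiction (sym eq) (All.lookup x∉ (∈-lookup i))
lookup-injective (_ ∷ u)  {suc i} {suc j} eq = cong suc (lookup-injective u eq)

-- `locate` may depend on the proof of `P v`; `at-locate` and the injectivity of `at` still force a
-- single index.
record Enumeration (P : A → Set) (k : ℕ) : Set where
  field
    at           : Fin k → A
    at-injective : ∀ {i j} → at i ≡ at j → i ≡ j
    at-∈         : ∀ i → P (at i)
    locate       : ∀ {v} → P v → Fin k
    at-locate    : ∀ {v} (p : P v) → at (locate p) ≡ v

open Enumeration

-- The head of the list receives index `zero`, the place that `xLabel` and `yLabel` reserve for `x`
-- and `y`.
enumerate : ∀ {x m} {xs : List A} → Unique (x ∷ xs) → length xs ≡ m → (∀ v → P v ⇔ v ∈ₗ x ∷ xs) →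
            Σ (Enumeration P (suc m)) λ e → at e zero ≡ x
enumerate {x = x} {xs = xs} u refl same = record
  { at           = List.lookup (x ∷ xs)
  ; at-injective = lookup-injective u
  ; at-∈         = λ i → Equivalence.from (same _) (∈-lookup i)
  ; locate       = λ {v} p → Any.index (Equivalence.to (same v) p)
  ; at-locate    = λ {v} p → sym (lookup-index (Equivalence.to (same v) p))
  } , refl

enumeration↔ : {P Q : A → Set} → ∀ {k l} → Enumeration P k → Enumeration Q l →
               (∀ v → P v ⊎ Q v) → (∀ {v} → P v → ¬ Q v) →
               A ↔ (Fin k ⊎ Fin l)
-- Since `from` is injective, the other inverse law follows from `from∘to`.
enumeration↔ {P = P} {Q = Q} e f cover exclusive = mk↔ₛ′ to from (λ l → from-injective (from∘to (from l))) from∘to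
  where
  to = λ v → Sum.map (locate e) (locate f) (cover v)
  from = Sum.[ at e , at f ]
  from∘to : ∀ v → from (to v) ≡ v
  from∘to v with cover v
  ... | inj₁ p = at-locate e p
  ... | inj₂ q = at-locate f q
  from-injective : ∀ {a b} → from a ≡ from b → a ≡ b
  from-injective {inj₁ i} {inj₁ j} eq = cong inj₁ (at-injective e eq)
  from-injective {inj₂ i} {inj₂ j} eq = cong inj₂ (at-injective f eq)
  from-injective {inj₁ i} {inj₂ j} eq = contradiction (subst Q (sym eq) (at-∈ f j)) (exclusive (at-∈ e i))
  from-injective {inj₂ i} {inj₁ j} eq = contradiction (subst Q eq (at-∈ f i)) (exclusive (at-∈ e j))

-- Two heavy vertices: adjacency and the side of `x`

larger-part : ∀ {d e m} → d + e ≡ m → m ≤ 2 * d → e ≤ d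
larger-part {d} {e} refl le = +-cancelˡ-≤ d e d (subst (d + e ≤_) (cong (d +_) (+-identityʳ d)) le)

record HeavyPair {n : ℕ} (G : Graph (Fin n)) (x y : Fin n) : Set where
  field
    x≢y      : x ≢ y
    x-heavy  : Heavy G x
    y-heavy  : Heavy G y
    only     : ∀ v → Heavy G v → v ≡ x ⊎ v ≡ y
    no-cycle : ¬ HeavyCycle G

swapPair : ∀ {n} {G : Graph (Fin n)} {x y} → HeavyPair G x y → HeavyPair G y x
swapPair p = record
  { x≢y = ≢-sym x≢y ; x-heavy = y-heavy ; y-heavy = x-heavy ; only = λ v → Sum.swap ∘ only v
  ; no-cycle = no-cycle }
  where open HeavyPair p

-- Everything is developed for `x`; the pair is symmetric, so `swapPair` yields the same facts for
-- `y`.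
module Side {n : ℕ} {G : Graph (Fin n)} {x y : Fin n} (pair : HeavyPair G x y) where

  open HeavyPair pair
  open import Data.List.Membership.DecPropositional (_≟_ {n}) using () renaming (_∈?_ to _∈ₗ?_)

  Common : Fin n → Set
  Common w = Adj G x w × Adj G y w

  adj⇒≢ : ∀ {u v} → Adj G u v → u ≢ v
  adj⇒≢ a eq = irrefl G eq a

  no-cycle-through : (C : Cycle G) → x ∈ₗ vertices C → ¬ y ∈ₗ vertices C
  no-cycle-through C x∈ y∈ = no-cycle (C , λ v hv → Sum.[ (λ { refl → x∈ }) , (λ { refl → y∈ }) ] (only v hv))

  -- Contrapositive of `heavy-pair-count`, in the form that produces a common neighbour.
  common-outside : ∀ l → Unique l → # (adj? G x) l + # (adj? G y) l < length l →
                   ∃ λ w → w ∉ₗ l × Common w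
  common-outside l unique few with any? (λ w → ¬? (w ∈ₗ? l) ×-dec (adj? G x w ×-dec adj? G y w))
  ... | yes common = common
  ... | no ¬common =
    contradiction (heavy-pair-count {G = G} {x} {y} x-heavy y-heavy unique (λ w w∉ c → ¬common (w , w∉ , c))) (<⇒≱ few)

  no-4-cycle : ∀ {a b} → Adj G x a → a ≢ y → Adj G a b → a ≢ b → Adj G b y → x ≢ b → ¬ Adj G y x
  no-4-cycle xa a≢y ab a≢b by x≢b yx = no-cycle-through
    (close (step xa (step ab (step by stop))) yx
      ((adj⇒≢ xa ∷ x≢b ∷ x≢y ∷ []) ∷ (a≢b ∷ a≢y ∷ []) ∷ (adj⇒≢ by ∷ []) ∷ [] ∷ []) (s≤s (s≤s (s≤s z≤n))))
    (here refl) (there (there (there (here refl))))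

  nonadjacent-# : ¬ Adj G x y → ∀ l →
                  # (adj? G x) (x ∷ y ∷ l) + # (adj? G y) (x ∷ y ∷ l) ≡ # (adj? G x) l + # (adj? G y) l
  nonadjacent-# ¬a l = cong₂ _+_
    (trans (#-reject (adj? G x) (irrefl G refl)) (#-reject (adj? G x) ¬a))
    (trans (#-reject (adj? G y) (¬a ∘ symm G)) (#-reject (adj? G y) (irrefl G refl)))

  -- For nonadjacent `x` and `y` the counts on the list `x`, `y` are zero. Adding the common
  -- neighbour `w` raises them to at most 2, still below the length 3, so `common-outside` applies
  -- again.
  two-common : ¬ Adj G x y → ∃₂ λ w w′ → w ≢ w′ × Common w × Common w′
  two-common ¬a
    with w , _ , c@(xw , yw) ← common-outside (x ∷ y ∷ []) ((x≢y ∷ []) ∷ [] ∷ [])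
           (subst (_< 2) (sym (nonadjacent-# ¬a [])) (s≤s z≤n))
    with w′ , w′∉ , c′ ← common-outside (x ∷ y ∷ w ∷ []) ((x≢y ∷ adj⇒≢ xw ∷ []) ∷ (adj⇒≢ yw ∷ []) ∷ [] ∷ [])
           (subst (_< 3) (sym (nonadjacent-# ¬a (w ∷ [])))
             (s≤s (+-mono-≤ (length-filter (adj? G x) (w ∷ [])) (length-filter (adj? G y) (w ∷ [])))))
    = w , w′ , (λ w≡w′ → w′∉ (there (there (here (sym w≡w′))))) , c , c′

  -- The excluded 4-cycle is `x`, `w`, `y`, `w′`. Together with `two-common` it forces `x` and `y`
  -- to be adjacent.
  no-two-common : ∀ {w w′} → w ≢ w′ → Common w → ¬ Common w′
  no-two-common w≢w′ (xw , yw) (xw′ , yw′) = no-cycle-through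
    (close (step xw (step (symm G yw) (step yw′ stop))) (symm G xw′)
      ((adj⇒≢ xw ∷ x≢y ∷ adj⇒≢ xw′ ∷ []) ∷ (≢-sym (adj⇒≢ yw) ∷ w≢w′ ∷ []) ∷ (adj⇒≢ yw′ ∷ []) ∷ [] ∷ [])
      (s≤s (s≤s (s≤s z≤n))))
    (here refl) (there (there (here refl)))

  adjacent : Adj G x y
  adjacent = decidable-stable (adj? G x y) λ ¬a →
    let (w , w′ , w≢w′ , c , c′) = two-common ¬a in no-two-common w≢w′ c c′

  no-triangle : ∀ w → ¬ Common w
  no-triangle w (xw , yw) = no-cycle-through
    (close (step xw (step (symm G yw) stop)) (symm G adjacent)
      ((adj⇒≢ xw ∷ x≢y ∷ []) ∷ (≢-sym (adj⇒≢ yw) ∷ []) ∷ [] ∷ []) (s≤s (s≤s (s≤s z≤n))))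
    (here refl) (there (there (here refl)))

  x-count : ∀ {w} → ¬ Adj G x w → # (adj? G x) (x ∷ y ∷ w ∷ []) ≡ 1
  x-count ¬xw = trans (#-reject (adj? G x) (irrefl G refl))
    (trans (#-accept (adj? G x) adjacent) (cong suc (#-reject (adj? G x) ¬xw)))

  y-count : ∀ {w} → ¬ Adj G y w → # (adj? G y) (x ∷ y ∷ w ∷ []) ≡ 1
  y-count ¬yw = trans (#-accept (adj? G y) (symm G adjacent))
    (cong suc (trans (#-reject (adj? G y) (irrefl G refl)) (#-reject (adj? G y) ¬yw)))

  -- Otherwise the only adjacencies counted on `x`, `y`, `w` are the two from the edge `xy`; 2 is
  -- below 3, so a common neighbour exists and gives a triangle.
  dominating : ∀ {w} → w ≢ x → w ≢ y → Adj G x w ⊎ Adj G y w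
  dominating {w} w≢x w≢y = decidable-stable (adj? G x w ⊎-dec adj? G y w) λ ¬a →
    let (z , _ , common) = common-outside (x ∷ y ∷ w ∷ [])
          ((x≢y ∷ ≢-sym w≢x ∷ []) ∷ (≢-sym w≢y ∷ []) ∷ [] ∷ [])
          (≤-reflexive (cong suc (cong₂ _+_ (x-count (¬a ∘ inj₁)) (y-count (¬a ∘ inj₂)))))
    in no-triangle z common

  -- Heaviness gives one inequality. For the other the neighbourhoods are disjoint, which is the
  -- overlap count with an empty list.
  degree-sum : degree G x + degree G y ≡ n
  degree-sum = ≤-antisym upper
    (subst (n ≤_) (cong₂ _+_ (sym (degree≡# {G = G} x)) (sym (degree≡# {G = G} y)))
      (heavy-sum {G = G} {x} {y} x-heavy y-heavy))
    where
    upper : degree G x + degree G y ≤ n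
    upper rewrite degree≡# {G = G} x | degree≡# {G = G} y = subst₂ _≤_ (+-identityʳ _) (+-identityʳ _)
      (#-overlap (adj? G x) (adj? G y) [] [] (λ w _ → no-triangle w))

  -- Used for both orders of the pair, this makes the two degrees equal, hence both n/2.
  degree-≤ : degree G y ≤ degree G x
  degree-≤ = larger-part {degree G x} {degree G y} {n} degree-sum x-heavy

  -- This turns out to be the component of `x` in `G - xy`; describing it by adjacency makes it
  -- decidable.
  On : Fin n → Set
  On v = v ≡ x ⊎ (Adj G x v × v ≢ y)

  on? : Decidable On
  on? v = (v ≟ x) ⊎-dec (adj? G x v ×-dec ¬? (v ≟ y))

  ¬on-y : ¬ On y
  ¬on-y (inj₁ y≡x)       = x≢y (sym y≡x)
  ¬on-y (inj₂ (_ , y≢y)) = y≢y refl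

  -- The conclusion is `On` with `x` and `y` exchanged, and `cover` uses it as such.
  ¬on⇒dominated : ∀ {v} → ¬ On v → v ≡ y ⊎ (Adj G y v × v ≢ x)
  ¬on⇒dominated {v} ¬on with v ≟ y
  ... | yes v≡y = inj₁ v≡y
  ... | no  v≢y = inj₂ (yv , ¬on ∘ inj₁)
    where
    yv : Adj G y v
    yv = Sum.fromInj₂ (λ xv → ⊥-elim (¬on (inj₂ (xv , v≢y)))) (dominating (¬on ∘ inj₁) v≢y)

  -- Any other edge leaving the side would complete a triangle or a 4-cycle through `x` and `y`.
  leaving : ∀ {u v} → On u → ¬ On v → Adj G u v → u ≡ x × v ≡ y
  leaving {u} {v} on-u ¬on-v uv = cases on-u (¬on⇒dominated ¬on-v)
    where
    cases : On u → v ≡ y ⊎ (Adj G y v × v ≢ x) → u ≡ x × v ≡ y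
    cases (inj₁ u≡x)        (inj₁ v≡y)        = u≡x , v≡y
    cases (inj₁ refl)       (inj₂ (yv , _))   = ⊥-elim (no-triangle v (uv , yv))
    cases (inj₂ (xu , _))   (inj₁ refl)       = ⊥-elim (no-triangle u (xu , symm G uv))
    cases (inj₂ (xu , u≢y)) (inj₂ (yv , v≢x)) =
      ⊥-elim (no-4-cycle xu u≢y uv (adj⇒≢ uv) (symm G yv) (≢-sym v≢x) (symm G adjacent))

  neighbour? : Decidable (λ v → Adj G x v × v ≢ y)
  neighbour? v = adj? G x v ×-dec ¬? (v ≟ y)

  others : List (Fin n)
  others = filter neighbour? (allFin n)

  side : List (Fin n)
  side = x ∷ others

  ∈-side : ∀ v → On v ⇔ v ∈ₗ side
  ∈-side v = mk⇔ to from
    where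
    to : On v → v ∈ₗ side
    to (inj₁ v≡x) = here v≡x
    to (inj₂ p)   = there (∈-filter⁺ neighbour? (∈-allFin v) p)
    from : v ∈ₗ side → On v
    from (here v≡x) = inj₁ v≡x
    from (there v∈) = inj₂ (proj₂ (∈-filter⁻ neighbour? {xs = allFin n} v∈))

  others-unique : Unique others
  others-unique = Unique.filter⁺ neighbour? (Unique.allFin⁺ n)

  side-unique : Unique side
  side-unique = All.tabulate (λ v∈ → adj⇒≢ (proj₁ (proj₂ (∈-filter⁻ neighbour? {xs = allFin n} v∈)))) ∷ others-unique

  -- Replacing the head `x` by `y` turns the side into the neighbourhood of `x`, without changing
  -- the length.
  length-side : length side ≡ degree G x
  length-side = sym (trans (degree≡# {G = G} x) (↭-length (unique∧same⇒↭
    (Unique.filter⁺ (adj? G x) (Unique.allFin⁺ n))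
    (All.tabulate (λ v∈ → ≢-sym (proj₂ (proj₂ (∈-filter⁻ neighbour? {xs = allFin n} v∈)))) ∷ others-unique)
    to from)))
    where
    to : ∀ v → v ∈ₗ filter (adj? G x) (allFin n) → v ∈ₗ y ∷ others
    to v v∈ with v ≟ y
    ... | yes v≡y = here v≡y
    ... | no  v≢y = there (∈-filter⁺ neighbour? (∈-allFin v) (proj₂ (∈-filter⁻ (adj? G x) {xs = allFin n} v∈) , v≢y))
    from : ∀ v → v ∈ₗ y ∷ others → v ∈ₗ filter (adj? G x) (allFin n)
    from v (here refl) = ∈-filter⁺ (adj? G x) (∈-allFin v) adjacent
    from v (there v∈)  = ∈-filter⁺ (adj? G x) (∈-allFin v) (proj₁ (proj₂ (∈-filter⁻ neighbour? {xs = allFin n} v∈)))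

  on-reaches : ∀ {v} → On v → Reachable (deleteEdge G x y) v x
  on-reaches (inj₁ refl)       = ε
  on-reaches (inj₂ (xv , v≢y)) =
    (symm G xv , Sum.[ (λ (_ , x≡y) → x≢y x≡y) , (λ (v≡y , _) → v≢y v≡y) ]) ◅ ε

-- Two heavy vertices: the components of `G - xy`

module TwoHeavy {n : ℕ} {G : Graph (Fin n)} {x y : Fin n} (pair : HeavyPair G x y)
  (connected : Connected G) where

  open HeavyPair pair using (x≢y)
  module X = Side pair
  module Y = Side (swapPair pair)

  G-xy : Graph (Fin n)
  G-xy = deleteEdge G x y

  exclusive : ∀ {v} → X.On v → ¬ Y.On v
  exclusive (inj₁ refl)       on-y              = Y.¬on-y on-y
  exclusive (inj₂ (_ , v≢y))  (inj₁ v≡y)        = v≢y v≡y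
  exclusive (inj₂ (xv , _))   (inj₂ (yv , _))   = X.no-triangle _ (xv , yv)

  cover : ∀ v → X.On v ⊎ Y.On v
  cover v with X.on? v
  ... | yes on  = inj₁ on
  ... | no  ¬on = inj₂ (X.¬on⇒dominated ¬on)

  -- `Y` speaks of `deleteEdge G y x`, which has the same edges as `G-xy` but is a different term.
  flip-reachable : ∀ {u v} → Reachable (deleteEdge G y x) u v → Reachable G-xy u v
  flip-reachable = gmap id (λ (a , ¬e) → a , ¬e ∘ Sum.swap)

  rep : Fin n → Fin n
  rep v = Sum.[ (λ _ → x) , (λ _ → y) ] (cover v)

  rep-x : ∀ {v} → X.On v → rep v ≡ x
  rep-x {v} on with cover v
  ... | inj₁ _   = refl
  ... | inj₂ on′ = contradiction on′ (exclusive on)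

  rep-y : ∀ {v} → Y.On v → rep v ≡ y
  rep-y {v} on with cover v
  ... | inj₁ on′ = contradiction on (exclusive on′)
  ... | inj₂ _   = refl

  rep≡x⇒on : ∀ {v} → rep v ≡ x → X.On v
  rep≡x⇒on {v} eq with cover v
  ... | inj₁ on = on
  ... | inj₂ _  = contradiction (sym eq) x≢y

  rep≡y⇒on : ∀ {v} → rep v ≡ y → Y.On v
  rep≡y⇒on {v} eq with cover v
  ... | inj₁ _  = contradiction eq x≢y
  ... | inj₂ on = on

  toRep : ∀ v → Reachable G-xy v (rep v)
  toRep v with cover v
  ... | inj₁ on = X.on-reaches on
  ... | inj₂ on = flip-reachable (Y.on-reaches on)

  rep-adj : ∀ {u v} → Adj G-xy u v → rep u ≡ rep v
  rep-adj {u} {v} (uv , ¬xy) with cover u | cover v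
  ... | inj₁ _  | inj₁ _   = refl
  ... | inj₂ _  | inj₂ _   = refl
  ... | inj₁ on | inj₂ on′ = contradiction (inj₁ (X.leaving on (λ on″ → exclusive on″ on′) uv)) ¬xy
  ... | inj₂ on | inj₁ on′ = contradiction (inj₂ (Y.leaving on (exclusive on′) uv)) ¬xy

  rep∈ : ∀ v → rep v ∈ₗ x ∷ y ∷ []
  rep∈ v with cover v
  ... | inj₁ _ = here refl
  ... | inj₂ _ = there (here refl)

  rep-fixes : ∀ {r} → r ∈ₗ x ∷ y ∷ [] → rep r ≡ r
  rep-fixes (here refl)         = rep-x (inj₁ refl)
  rep-fixes (there (here refl)) = rep-y (inj₁ refl)

  module Rep = Representatives G-xy rep (x ∷ y ∷ []) rep∈ rep-fixes toRep rep-adj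

  two-components : ComponentCount G-xy 2
  two-components = Rep.componentCount ((x≢y ∷ []) ∷ [] ∷ [])

  cut-edge : IsCutEdge G x y
  cut-edge = X.adjacent , 1 , 2 , one-component , two-components , ≤-refl
    where
    one-component : ComponentCount G 1
    one-component = Representatives.componentCount G (λ _ → x) (x ∷ []) (λ _ → here refl)
      (λ { (here refl) → refl }) (λ v → proj₂ connected v x) (λ _ → refl) ([] ∷ [])

  degree≡ : degree G y ≡ degree G x
  degree≡ = ≤-antisym X.degree-≤ Y.degree-≤

  n≡degree+degree : n ≡ degree G x + degree G x
  n≡degree+degree = trans (sym X.degree-sum) (cong (degree G x +_) degree≡)

  n≡degree*2 : n ≡ degree G x * 2
  n≡degree*2 = trans n≡degree+degree (double (degree G x))
    where
    double : ∀ d → d + d ≡ d * 2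
    double = solve-∀

  half : degree G x ≡ n / 2
  half = sym (trans (cong (_/ 2) n≡degree*2) (m*n/n≡m (degree G x) 2))

  -- The component is the side containing `u`, and each side has as many vertices as the degree of
  -- its heavy vertex.
  component-size : ∀ C → IsComponent G-xy C → ∣ C ∣ ≡ n / 2
  component-size C (u , members) with cover u
  ... | inj₁ on = trans (∣C∣≡length C X.side X.side-unique same) (trans X.length-side half)
    where
    same : ∀ v → v ∈ C ⇔ v ∈ₗ X.side
    same v = mk⇔
      (λ v∈ → Equivalence.to (X.∈-side v)
        (rep≡x⇒on (trans (sym (Rep.rep-reachable (Equivalence.to (members v) v∈))) (rep-x on))))
      (λ v∈ → Equivalence.from (members v)
        (Rep.same-rep⇒reachable (trans (rep-x on) (sym (rep-x (Equivalence.from (X.∈-side v) v∈))))))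
  ... | inj₂ on = trans (∣C∣≡length C Y.side Y.side-unique same) (trans Y.length-side (trans degree≡ half))
    where
    same : ∀ v → v ∈ C ⇔ v ∈ₗ Y.side
    same v = mk⇔
      (λ v∈ → Equivalence.to (Y.∈-side v)
        (rep≡y⇒on (trans (sym (Rep.rep-reachable (Equivalence.to (members v) v∈))) (rep-y on))))
      (λ v∈ → Equivalence.from (members v)
        (Rep.same-rep⇒reachable (trans (rep-y on) (sym (rep-y (Equivalence.from (Y.∈-side v) v∈))))))

  same-component : ∀ {C u v} → IsComponent G-xy C → u ∈ C → v ∈ C → rep u ≡ rep v
  same-component (_ , members) u∈ v∈ = trans
    (sym (Rep.rep-reachable (Equivalence.to (members _) u∈)))
    (Rep.rep-reachable (Equivalence.to (members _) v∈))

  x-dominates : ∀ C → IsComponent G-xy C → x ∈ C → ∀ v → v ∈ C → v ≢ x → Adj G x v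
  x-dominates C c x∈ v v∈ v≢x
    with rep≡x⇒on (trans (sym (same-component c x∈ v∈)) (rep-x (inj₁ refl)))
  ... | inj₁ v≡x      = contradiction v≡x v≢x
  ... | inj₂ (xv , _) = xv

  y-dominates : ∀ C → IsComponent G-xy C → y ∈ C → ∀ v → v ∈ C → v ≢ y → Adj G y v
  y-dominates C c y∈ v v∈ v≢y
    with rep≡y⇒on (trans (sym (same-component c y∈ v∈)) (rep-y (inj₁ refl)))
  ... | inj₁ v≡y      = contradiction v≡y v≢y
  ... | inj₂ (yv , _) = yv

  -- The labelling between `T₁` and `T₂`

  m : ℕ
  m = length X.others

  n≡ : n ≡ suc m + suc m
  n≡ = trans n≡degree+degree (sym (cong₂ _+_ X.length-side X.length-side))

  labelX : Σ (Enumeration X.On (suc m)) λ e → at e zero ≡ x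
  labelX = enumerate X.side-unique refl X.∈-side

  labelY : Σ (Enumeration Y.On (suc m)) λ e → at e zero ≡ y
  labelY = enumerate Y.side-unique
    (suc-injective (trans Y.length-side (trans degree≡ (sym X.length-side)))) Y.∈-side

  eX = proj₁ labelX
  eY = proj₁ labelY

  σ : Fin n ↔ Label m
  σ = enumeration↔ eX eY cover exclusive

  open Inverse σ using (to; from; strictlyInverseˡ; strictlyInverseʳ)

  σ-x : to x ≡ xLabel
  σ-x = trans (cong to (sym (proj₂ labelX))) (strictlyInverseˡ xLabel)

  σ-y : to y ≡ yLabel
  σ-y = trans (cong to (sym (proj₂ labelY))) (strictlyInverseˡ yLabel)

  x-spoke : ∀ {j} → j ≢ zero → Adj G x (at eX j)
  x-spoke {j} j≢0 with at-∈ eX j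
  ... | inj₁ eq       = contradiction (at-injective eX (trans eq (sym (proj₂ labelX)))) j≢0
  ... | inj₂ (xv , _) = xv

  y-spoke : ∀ {j} → j ≢ zero → Adj G y (at eY j)
  y-spoke {j} j≢0 with at-∈ eY j
  ... | inj₁ eq       = contradiction (at-injective eY (trans eq (sym (proj₂ labelY)))) j≢0
  ... | inj₂ (yv , _) = yv

  T₁⊆G : T₁ m ⊆[ from ] G
  T₁⊆G (inj₁ _) (inj₁ j) (inj₁ (refl , j≢0)) = subst (λ u → Adj G u (at eX j)) (sym (proj₂ labelX)) (x-spoke j≢0)
  T₁⊆G (inj₁ i) (inj₁ _) (inj₂ (refl , i≢0)) = subst (Adj G (at eX i)) (sym (proj₂ labelX)) (symm G (x-spoke i≢0))
  T₁⊆G (inj₂ _) (inj₂ j) (inj₁ (refl , j≢0)) = subst (λ u → Adj G u (at eY j)) (sym (proj₂ labelY)) (y-spoke j≢0)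
  T₁⊆G (inj₂ i) (inj₂ _) (inj₂ (refl , i≢0)) = subst (Adj G (at eY i)) (sym (proj₂ labelY)) (symm G (y-spoke i≢0))
  T₁⊆G (inj₁ _) (inj₂ _) (refl , refl) = subst₂ (Adj G) (sym (proj₂ labelX)) (sym (proj₂ labelY)) X.adjacent
  T₁⊆G (inj₂ _) (inj₁ _) (refl , refl) = subst₂ (Adj G) (sym (proj₂ labelY)) (sym (proj₂ labelX)) Y.adjacent

  bridge : ∀ {i j} → Adj G (at eX i) (at eY j) → i ≡ zero × j ≡ zero
  bridge {i} {j} a with p , q ← X.leaving (at-∈ eX i) (λ on → exclusive on (at-∈ eY j)) a =
    at-injective eX (trans p (sym (proj₂ labelX))) , at-injective eY (trans q (sym (proj₂ labelY)))

  -- Stated on labels so that the sides can be matched on. Within a side any edge is allowed by the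
  -- complete graph; between sides `bridge` leaves only `xy`.
  from-adj : ∀ k l → Adj G (from k) (from l) → Adj (T₂ m) k l
  from-adj (inj₁ i) (inj₁ j) a = λ { refl → irrefl G refl a }
  from-adj (inj₂ i) (inj₂ j) a = λ { refl → irrefl G refl a }
  from-adj (inj₁ i) (inj₂ j) a = bridge a
  from-adj (inj₂ i) (inj₁ j) a = swap (bridge (symm G a))

  G⊆T₂ : G ⊆[ to ] T₂ m
  G⊆T₂ u v a = from-adj (to u) (to v)
    (subst₂ (Adj G) (sym (strictlyInverseʳ u)) (sym (strictlyInverseʳ v)) a)

-- Conclusions

one-heavy : ∀ {n} (G : Graph (Fin n)) → Connected G → ¬ HeavyCycle G →
  ∀ x → Heavy G x → (∀ v → Heavy G v → v ≡ x) →
  (∃ λ k → ComponentCount (deleteVertex G x) k × n ≤ 2 * k) ×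
  (∀ C → IsComponent (deleteVertex G x) C → ∃! _≡_ λ v → v ∈ C × Adj G x (restore x v))
-- Matching `suc n` lets `restore` compute to `punchIn`, the form used in `DeleteVertex`.
one-heavy {suc n} G connected no-cycle x hx only =
  -- With `degree G x` as the number of components, the required bound is `hx` itself.
  (degree G x , componentCount-degree connected no-x-cycle , hx) , one-attached connected no-x-cycle
  where
  open DeleteVertex G x
  no-x-cycle : ¬ Σ (Cycle G) λ C → x ∈ₗ vertices C
  no-x-cycle (C , x∈) = no-cycle (C , λ v hv → subst (_∈ₗ vertices C) (sym (only v hv)) x∈)

theorem2 : ∀ (n : ℕ) (G : Graph (Fin n)) → Connected G → ¬ HeavyCycle G →
  (heavyCount G ≤ 2)
  × ((∀ v → ¬ Heavy G v) → IsTree G)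
  × (∀ x → Heavy G x → (∀ v → Heavy G v → v ≡ x) →
      (∃ λ k → ComponentCount (deleteVertex G x) k × n ≤ 2 * k)
      × (∀ C → IsComponent (deleteVertex G x) C →
          ∃! _≡_ λ v → v ∈ C × Adj G x (restore x v)))
  × (∀ x y → x ≢ y → Heavy G x → Heavy G y →
      (∀ v → Heavy G v → v ≡ x ⊎ v ≡ y) →
      Adj G x y
      × IsCutEdge G x y
      × 2 ∣ n
      × ComponentCount (deleteEdge G x y) 2
      × (∀ C → IsComponent (deleteEdge G x y) C → ∣ C ∣ ≡ n / 2)
      × (∀ C → IsComponent (deleteEdge G x y) C → x ∈ C →
          ∀ v → v ∈ C → v ≢ x → Adj G x v)
      × (∀ C → IsComponent (deleteEdge G x y) C → y ∈ C →
          ∀ v → v ∈ C → v ≢ y → Adj G y v)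
      × (∃ λ m → n ≡ suc m + suc m
          × Σ (Fin n ↔ Label m) λ σ →
              Inverse.to σ x ≡ xLabel
              × Inverse.to σ y ≡ yLabel
              × T₁ m ⊆[ Inverse.from σ ] G
              × G ⊆[ Inverse.to σ ] T₂ m))
theorem2 n G connected no-cycle =
    heavyCount≤2 no-cycle
  -- Without heavy vertices any cycle is vacuously heavy.
  , (λ none → connected , λ C → no-cycle (C , λ v hv → contradiction hv (none v)))
  , one-heavy G connected no-cycle
  , λ x y x≢y hx hy only →
      let pair = record { x≢y = x≢y ; x-heavy = hx ; y-heavy = hy ; only = only ; no-cycle = no-cycle }
          open TwoHeavy pair connected
      in X.adjacent , cut-edge , divides (degree G x) n≡degree*2 , two-components , component-size
       , x-dominates , y-dominates , m , n≡ , σ , σ-x , σ-y , T₁⊆G , G⊆T₂
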